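{- Let $n$ be a positive integer and let $x$ be a complex number for which all the expressions below are defined. Then \[ \sum_{k=0}^{n}(-1)^k\binom{n}{k}\frac{\binom{2x+k}{k}}{\binom{2x+n+k}{k}}H_{k}(x) =4^{n-1}\frac{\binom{n-\frac{1}{2}}{n}}{\binom{2x+2n}{n}}\big\{H_n(x)+H_n-2H_{2n}\big\} -\frac{4^{n-1}}{n}\frac{\binom{x+n-\frac{1}{2}}{n}}{\binom{2x+2n}{n}\binom{x+n}{n}}. \]
   Context: For a complex number $z$ and a nonnegative integer $t$, $\binom{z}{t}=\frac{z(z-1)\cdots(z-t+1)}{t!}$ (with $\binom{z}{0}=1$). For complex $x$, $H_0(x)=0$ and $H_m(x)=\sum_{j=1}^m\frac{1}{x+j}$ for $m\ge1$; $H_m=H_m(0)=\sum_{j=1}^m\frac1j$. -}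

module Defs where

open import Level using (Level; _⊔_) renaming (suc to lsuc)
open import Data.Nat using (ℕ; zero; suc; _≤_)
open import Data.Nat.Base using (_!)
open import Algebra.Bundles using (CommutativeRing)
open import Relation.Nullary using (¬_)

ringFromℕ : ∀ {c ℓ} (R : CommutativeRing c ℓ) → ℕ → CommutativeRing.Carrier R
ringFromℕ R zero    = CommutativeRing.0# R
ringFromℕ R (suc n) = CommutativeRing._+_ R (CommutativeRing.1# R) (ringFromℕ R n)

-- A field of characteristic zero (ℂ is an instance).  The inverse is a total
-- function; its value at 0 is irrelevant since every statement below assumes
-- the relevant denominators are nonzero.
record CharZeroField (c ℓ : Level) : Set (lsuc (c ⊔ ℓ)) where
  field
    commutativeRing : CommutativeRing c ℓ
  open CommutativeRing commutativeRing public
  field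
    _⁻¹      : Carrier → Carrier
    ⁻¹-cong  : ∀ {x y} → x ≈ y → x ⁻¹ ≈ y ⁻¹
    inverseʳ : ∀ x → ¬ (x ≈ 0#) → x * (x ⁻¹) ≈ 1#
    charZero : ∀ n → ¬ (ringFromℕ commutativeRing (suc n) ≈ 0#)

  fromℕ : ℕ → Carrier
  fromℕ = ringFromℕ commutativeRing

module FieldNotation {c ℓ} (F : CharZeroField c ℓ) where
  open CharZeroField F hiding (zero)

  infixl 7 _÷_
  _÷_ : Carrier → Carrier → Carrier
  x ÷ y = x * (y ⁻¹)

  pow : Carrier → ℕ → Carrier
  pow z zero    = 1#
  pow z (suc t) = pow z t * z

  falling : Carrier → ℕ → Carrier
  falling z zero    = 1#
  falling z (suc t) = falling z t * (z - fromℕ t)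

  binom : Carrier → ℕ → Carrier
  binom z t = falling z t ÷ fromℕ (t !)

  H : ℕ → Carrier → Carrier
  H zero    x = 0#
  H (suc m) x = H m x + (x + fromℕ (suc m)) ⁻¹

  Harm : ℕ → Carrier
  Harm m = H m 0#

  sumTo : ℕ → (ℕ → Carrier) → Carrier
  sumTo zero    f = f zero
  sumTo (suc n) f = sumTo n f + f (suc n)

{-# OPTIONS --safe #-}

-- Write (z)ₘ for the rising factorial and Θ n a b f = Σₖ (-1)ᵏ C(n,k) (a)ₖ (b+k)ₙ₋ₖ f(k).
-- After multiplication by (2x+n+1)ₙ the left-hand side is Θ n a (a+n) H with a = 2x+1 and
-- H(k) = Hₖ(x).  The contiguous relations of Θ express the step n → n+1 through the
-- sums D, E with f(k) = 1/(x+1+k), because H(k+1) - H(k) = f(k).  For this f the sums are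
-- well-poised, and a first-order recurrence evaluates D (a case of Dixon's theorem).
-- Multiplying out (2x+n+1)ₙ matters: its zeros move with n, so the quotients
-- occurring in the theorem for a smaller n need not be defined.

module Submission where

open import Defs
open import Level using (Level)
open import Algebra.Bundles using (CommutativeRing)
import Algebra.Properties.Ring as RingProperties
import Algebra.Properties.Semiring.Mult.TCOptimised as Multiples
import Algebra.Solver.Ring as RingSolver
open import Algebra.Solver.Ring.AlmostCommutativeRing
  using (fromCommutativeRing; _-Raw-AlmostCommutative⟶_)
import Data.Integer as ℤ
import Data.Integer.Properties as ℤₚ
open import Data.Maybe.Base using (Maybe; just; nothing)
import Data.Nat as ℕ
open import Data.Nat using (ℕ; zero; suc; _≤_; z≤n; s≤s; _∸_; _^_; NonZero)
open import Data.Nat.Base using (_!)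
import Data.Nat.Properties as ℕₚ
import Data.Sign as Sign
open import Data.Sum using (inj₁; inj₂)
open import Function using (_∘_)
open import Relation.Binary.PropositionalEquality as ≡ using ()
open import Relation.Nullary using (¬_; yes; no)

-- Normalisation of ring expressions with integer coefficients.

module IntegerSolver {c ℓ} (R : CommutativeRing c ℓ) where
  open CommutativeRing R hiding (zero)
  open RingProperties ring
  open Multiples semiring using (_×_; ×-homo-+; ×1-homo-*)
  open import Relation.Binary.Reasoning.Setoid setoid

  -- The optimised `_×_` computes `1 × 1#` to `1#`, so the solver constants 0 and 1 denote `0#` and
  -- `1#` definitionally.
  fromℤ : ℤ.ℤ → Carrier
  fromℤ (ℤ.+ n)      = n × 1#
  fromℤ (ℤ.-[1+ n ]) = - (suc n × 1#)

  fromℤ-neg : ∀ i → fromℤ (ℤ.- i) ≈ - fromℤ i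
  fromℤ-neg (ℤ.+ zero)    = sym -0#≈0#
  fromℤ-neg (ℤ.+ (suc n)) = refl
  fromℤ-neg (ℤ.-[1+ n ])  = sym (-‿involutive _)

  ×1-∸ : ∀ {m n} → n ℕ.≤ m → (m ℕ.∸ n) × 1# ≈ m × 1# - n × 1#
  ×1-∸ {m} {n} n≤m = begin
    (m ℕ.∸ n) × 1#                              ≈⟨ +-identityʳ _ ⟨
    (m ℕ.∸ n) × 1# + 0#                         ≈⟨ +-congˡ (-‿inverseʳ _) ⟨
    (m ℕ.∸ n) × 1# + (n × 1# - n × 1#)          ≈⟨ +-assoc _ _ _ ⟨
    (m ℕ.∸ n) × 1# + n × 1# - n × 1#            ≈⟨ +-congʳ (×-homo-+ 1# (m ℕ.∸ n) n) ⟨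
    (m ℕ.∸ n ℕ.+ n) × 1# - n × 1#               ≈⟨ +-congʳ (reflexive (≡.cong (_× 1#) (ℕₚ.m∸n+n≡m n≤m))) ⟩
    m × 1# - n × 1#                             ∎

  fromℤ-⊖ : ∀ m n → fromℤ (m ℤ.⊖ n) ≈ m × 1# - n × 1#
  fromℤ-⊖ m n with ℕₚ.≤-total n m
  ... | inj₁ n≤m = trans (reflexive (≡.cong fromℤ (ℤₚ.⊖-≥ n≤m))) (×1-∸ n≤m)
  ... | inj₂ m≤n = begin
    fromℤ (m ℤ.⊖ n)           ≡⟨ ≡.cong fromℤ (ℤₚ.⊖-≤ m≤n) ⟩
    fromℤ (ℤ.- (ℤ.+ (n ℕ.∸ m))) ≈⟨ fromℤ-neg (ℤ.+ (n ℕ.∸ m)) ⟩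
    - ((n ℕ.∸ m) × 1#)          ≈⟨ -‿cong (×1-∸ m≤n) ⟩
    - (n × 1# - m × 1#)       ≈⟨ ⁻¹-anti-homo-// _ _ ⟩
    m × 1# - n × 1#           ∎

  fromℤ-+ : ∀ i j → fromℤ (i ℤ.+ j) ≈ fromℤ i + fromℤ j
  fromℤ-+ (ℤ.+ m)      (ℤ.+ n)      = ×-homo-+ 1# m n
  fromℤ-+ (ℤ.+ m)      (ℤ.-[1+ n ]) = fromℤ-⊖ m (suc n)
  fromℤ-+ (ℤ.-[1+ m ]) (ℤ.+ n)      = trans (fromℤ-⊖ n (suc m)) (+-comm _ _)
  fromℤ-+ (ℤ.-[1+ m ]) (ℤ.-[1+ n ]) = begin
    - (suc (suc (m ℕ.+ n)) × 1#)   ≡⟨ ≡.cong (λ k → - (k × 1#)) (≡.sym (ℕₚ.+-suc (suc m) n)) ⟩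
    - ((suc m ℕ.+ suc n) × 1#)     ≈⟨ -‿cong (×-homo-+ 1# (suc m) (suc n)) ⟩
    - (suc m × 1# + suc n × 1#)    ≈⟨ -‿+-comm _ _ ⟨
    - (suc m × 1#) - suc n × 1#    ∎

  fromℤ-neg◃ : ∀ n → fromℤ (Sign.- ℤ.◃ n) ≈ - (n × 1#)
  fromℤ-neg◃ zero    = sym -0#≈0#
  fromℤ-neg◃ (suc n) = refl

  fromℤ-* : ∀ i j → fromℤ (i ℤ.* j) ≈ fromℤ i * fromℤ j
  fromℤ-* (ℤ.+ m)      (ℤ.+ n)      =
    trans (reflexive (≡.cong fromℤ (ℤₚ.+◃n≡+n (m ℕ.* n)))) (×1-homo-* m n)
  fromℤ-* (ℤ.+ m)      (ℤ.-[1+ n ]) = begin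
    fromℤ (Sign.- ℤ.◃ m ℕ.* suc n) ≈⟨ fromℤ-neg◃ (m ℕ.* suc n) ⟩
    - ((m ℕ.* suc n) × 1#)         ≈⟨ -‿cong (×1-homo-* m (suc n)) ⟩
    - (m × 1# * suc n × 1#)        ≈⟨ -‿distribʳ-* _ _ ⟩
    m × 1# * - (suc n × 1#)        ∎
  fromℤ-* (ℤ.-[1+ m ]) (ℤ.+ n)      = begin
    fromℤ (Sign.- ℤ.◃ suc m ℕ.* n) ≈⟨ fromℤ-neg◃ (suc m ℕ.* n) ⟩
    - ((suc m ℕ.* n) × 1#)         ≈⟨ -‿cong (×1-homo-* (suc m) n) ⟩
    - (suc m × 1# * n × 1#)        ≈⟨ -‿distribˡ-* _ _ ⟩
    - (suc m × 1#) * n × 1#        ∎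
  fromℤ-* (ℤ.-[1+ m ]) (ℤ.-[1+ n ]) = begin
    (suc m ℕ.* suc n) × 1#               ≈⟨ ×1-homo-* (suc m) (suc n) ⟩
    suc m × 1# * suc n × 1#              ≈⟨ -‿involutive _ ⟨
    - - (suc m × 1# * suc n × 1#)        ≈⟨ -‿cong (-‿distribˡ-* _ _) ⟩
    - (- (suc m × 1#) * suc n × 1#)      ≈⟨ -‿distribʳ-* _ _ ⟩
    - (suc m × 1#) * - (suc n × 1#)      ∎

  homomorphism : ℤ.+-*-rawRing
                   -Raw-AlmostCommutative⟶ fromCommutativeRing R
  homomorphism = record
    { ⟦_⟧    = fromℤ
    ; +-homo = fromℤ-+
    ; *-homo = fromℤ-*
    ; -‿homo = fromℤ-neg
    ; 0-homo = refl
    ; 1-homo = refl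
    }

  -- Different integers may still agree in `R`, so a failed comparison gives no verdict; the solver
  -- needs positive answers only.
  fromℤ-≟ : ∀ i j → Maybe (fromℤ i ≈ fromℤ j)
  fromℤ-≟ i j with i ℤ.≟ j
  ... | yes i≡j = just (reflexive (≡.cong fromℤ i≡j))
  ... | no  _   = nothing

  open RingSolver _ (fromCommutativeRing R) homomorphism fromℤ-≟ public

-- Contiguous relations of alternating sums over a commutative ring.

module Contiguous {c ℓ} (R : CommutativeRing c ℓ) where
  open CommutativeRing R hiding (zero)
  open IntegerSolver R
  open import Relation.Binary.Reasoning.Setoid setoid

  private
    fromℕ : ℕ → Carrier
    fromℕ = ringFromℕ R

  :1 : ∀ {n} → Polynomial n
  :1 = con (ℤ.+ 1)

  -- Unfolds exactly as `fromℕ` does, so numerals such as `fromℕ 2` match definitionally; the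
  -- constant `con (ℤ.+ m)` would denote `m × 1#`.
  :ℕ : ∀ {n} → ℕ → Polynomial n
  :ℕ zero    = con (ℤ.+ 0)
  :ℕ (suc m) = :1 :+ :ℕ m

  ≈⇒-≈0 : ∀ {u v} → u ≈ v → u - v ≈ 0#
  ≈⇒-≈0 {u} {v} u≈v = trans (+-congʳ u≈v) (-‿inverseʳ v)

  -- Derive an equation from others by giving their cofactors; what remains is a
  -- polynomial identity for the ring solver.
  linear₁ : ∀ {p q u v} k → u ≈ v → p ≈ q + k * (u - v) → p ≈ q
  linear₁ {p} {q} {u} {v} k u≈v eq = begin
    p                ≈⟨ eq ⟩
    q + k * (u - v)  ≈⟨ +-congˡ (trans (*-congˡ (≈⇒-≈0 u≈v)) (zeroʳ k)) ⟩
    q + 0#           ≈⟨ +-identityʳ q ⟩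
    q                ∎

  linear₂ : ∀ {p q u v u′ v′} k k′ → u ≈ v → u′ ≈ v′ →
            p ≈ q + k * (u - v) + k′ * (u′ - v′) → p ≈ q
  linear₂ k k′ u≈v u′≈v′ eq = linear₁ k u≈v (linear₁ k′ u′≈v′ eq)

  linear₃ : ∀ {p q u v u′ v′ u″ v″} k k′ k″ → u ≈ v → u′ ≈ v′ → u″ ≈ v″ →
            p ≈ q + k * (u - v) + k′ * (u′ - v′) + k″ * (u″ - v″) → p ≈ q
  linear₃ k k′ k″ h h′ h″ eq = linear₁ k h (linear₂ k′ k″ h′ h″ eq)

  poch : Carrier → ℕ → Carrier
  poch z zero    = 1#
  poch z (suc m) = poch z m * (z + fromℕ m)

  poch-cong : ∀ {z w} m → z ≈ w → poch z m ≈ poch w m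
  poch-cong zero    z≈w = refl
  poch-cong (suc m) z≈w = *-cong (poch-cong m z≈w) (+-congʳ z≈w)

  poch-suc : ∀ z m → poch z (suc m) ≈ z * poch (z + 1#) m
  poch-suc z zero    = solve 1 (λ z → :1 :* (z :+ con (ℤ.+ 0)) := z :* :1) refl z
  poch-suc z (suc m) = linear₁ (z + fromℕ (suc m)) (poch-suc z m)
    (solve 4 (λ z m p q → p :* (z :+ (:1 :+ m))
       := z :* (q :* (z :+ :1 :+ m)) :+ (z :+ (:1 :+ m)) :* (p :- z :* q))
       refl z (fromℕ m) (poch z (suc m)) (poch (z + 1#) m))

  -- Pascal's rule for the sum in the header, taken as the definition; see Θ≈sum.
  Θ : ℕ → Carrier → Carrier → (ℕ → Carrier) → Carrier
  Θ zero    a b f = f 0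
  Θ (suc n) a b f = (b + fromℕ n) * Θ n a b f - a * Θ n (a + 1#) (b + 1#) (f ∘ suc)

  -- Agreement is asked for `k ≤ n` only, because facts such as `(c + k) f(k) = 1` are available
  -- only on that range.
  Θ-cong : ∀ n {a a′ b b′ f g} → a ≈ a′ → b ≈ b′ → (∀ k → k ≤ n → f k ≈ g k) →
           Θ n a b f ≈ Θ n a′ b′ g
  Θ-cong zero    a≈ b≈ f≈ = f≈ 0 z≤n
  Θ-cong (suc n) a≈ b≈ f≈ = +-cong
    (*-cong (+-congʳ b≈) (Θ-cong n a≈ b≈ (λ k k≤n → f≈ k (ℕₚ.m≤n⇒m≤1+n k≤n))))
    (-‿cong (*-cong a≈ (Θ-cong n (+-congʳ a≈) (+-congʳ b≈) (λ k k≤n → f≈ (suc k) (s≤s k≤n)))))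

  Θ-congᵇ : ∀ n {a b b′} f → b ≈ b′ → Θ n a b f ≈ Θ n a b′ f
  Θ-congᵇ n f b≈ = Θ-cong n refl b≈ (λ _ _ → refl)

  Θ-linear : ∀ n a b s f g → Θ n a b (λ k → s * f k + g k) ≈ s * Θ n a b f + Θ n a b g
  Θ-linear zero    a b s f g = refl
  Θ-linear (suc n) a b s f g = linear₂ (b + fromℕ n) (- a)
    (Θ-linear n a b s f g) (Θ-linear n (a + 1#) (b + 1#) s (f ∘ suc) (g ∘ suc))
    (solve 9 (λ a b′ s t t′ x x′ y y′ →
       b′ :* t :- a :* t′ := s :* (b′ :* x :- a :* x′) :+ (b′ :* y :- a :* y′)
         :+ b′ :* (t :- (s :* x :+ y)) :+ :- a :* (t′ :- (s :* x′ :+ y′)))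
       refl a (b + fromℕ n) s _ _ (Θ n a b f) (Θ n (a + 1#) (b + 1#) (f ∘ suc))
       (Θ n a b g) (Θ n (a + 1#) (b + 1#) (g ∘ suc)))

  -- Chu–Vandermonde.
  Θ-one : ∀ n a b → Θ n a b (λ _ → 1#) ≈ poch (b - a) n
  Θ-one zero    a b = refl
  Θ-one (suc n) a b = linear₂ (b + fromℕ n) (- a) (Θ-one n a b)
    (trans (Θ-one n (a + 1#) (b + 1#)) (poch-cong n
      (solve 2 (λ a b → (b :+ :1) :- (a :+ :1) := b :- a) refl a b)))
    (solve 6 (λ a b m t t′ p → (b :+ m) :* t :- a :* t′
       := p :* ((b :- a) :+ m) :+ (b :+ m) :* (t :- p) :+ :- a :* (t′ :- p))
       refl a b (fromℕ n) _ _ (poch (b - a) n))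

  -- Write `b - a = (b+k) - (a+k)` in the k-th term: `b+k` extends the Pochhammer symbol of `b`
  -- downwards and `a+k` that of `a` upwards. This and the next relations have such termwise
  -- reasons, but are proved by induction along the recursion of `Θ`, which avoids binomials and
  -- hence division.
  Θ-shift-a : ∀ n a b f →
    (b - a) * Θ n a (b + 1#) f ≈ (b + fromℕ n) * Θ n a b f - a * Θ n (a + 1#) (b + 1#) f
  Θ-shift-a zero    a b f =
    solve 3 (λ a b f → (b :- a) :* f := (b :+ con (ℤ.+ 0)) :* f :- a :* f) refl a b (f 0)
  Θ-shift-a (suc n) a b f = linear₂ (b + 1# + fromℕ n) (- a)
    (Θ-shift-a n a b f) (Θ-shift-a n (a + 1#) (b + 1#) (f ∘ suc))
    (solve 9 (λ a b m t t₁ t₂ s s₁ s₂ →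
       (b :- a) :* ((b :+ :1 :+ m) :* t :- a :* s)
       := (b :+ (:1 :+ m)) :* ((b :+ m) :* t₁ :- a :* s₁)
          :- a :* ((b :+ :1 :+ m) :* t₂ :- (a :+ :1) :* s₂)
          :+ (b :+ :1 :+ m) :* ((b :- a) :* t :- ((b :+ m) :* t₁ :- a :* t₂))
          :+ :- a :* (((b :+ :1) :- (a :+ :1)) :* s
                     :- ((b :+ :1 :+ m) :* s₁ :- (a :+ :1) :* s₂)))
       refl a b (fromℕ n) (Θ n a (b + 1#) f) (Θ n a b f) (Θ n (a + 1#) (b + 1#) f)
       (Θ n (a + 1#) (b + 1# + 1#) (f ∘ suc)) (Θ n (a + 1#) (b + 1#) (f ∘ suc))
       (Θ n (a + 1# + 1#) (b + 1# + 1#) (f ∘ suc)))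

  -- In the recursion of `Θ`, `f ∘ suc` is `f + g`; `Θ-shift-a` merges the two sums in `f` into one.
  Θ-difference : ∀ n a b f g → (∀ k → k ≤ n → f (suc k) ≈ f k + g k) →
    Θ (suc n) a b f ≈ (b - a) * Θ n a (b + 1#) f - a * Θ n (a + 1#) (b + 1#) g
  Θ-difference n a b f g Δf≈g = linear₂ (- 1#) (- a) (Θ-shift-a n a b f)
    (trans (Θ-cong n refl refl (λ k k≤n → trans (Δf≈g k k≤n) (+-congʳ (sym (*-identityˡ _)))))
           (Θ-linear n (a + 1#) (b + 1#) 1# f g))
    (solve 8 (λ a b m t t₁ t₂ u s →
       (b :+ m) :* t :- a :* u
       := (b :- a) :* t₁ :- a :* s
          :+ :- :1 :* ((b :- a) :* t₁ :- ((b :+ m) :* t :- a :* t₂))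
          :+ :- a :* (u :- (:1 :* t₂ :+ s)))
       refl a b (fromℕ n) (Θ n a b f) (Θ n a (b + 1#) f) (Θ n (a + 1#) (b + 1#) f)
       (Θ n (a + 1#) (b + 1#) (f ∘ suc)) (Θ n (a + 1#) (b + 1#) g))

  -- Termwise, changing `b` to `b+1` adds `(n+1-k) (b+1+k)ₙ₋ₖ`, and
  -- `(n+1-k) C(n+1,k) = (n+1) C(n,k)`.
  Θ-lower-b : ∀ n a b f →
    Θ (suc n) a b f ≈ Θ (suc n) a (b + 1#) f - fromℕ (suc n) * Θ n a (b + 1#) f
  Θ-lower-b zero a b f = solve 4 (λ a b f g →
      (b :+ con (ℤ.+ 0)) :* f :- a :* g
      := ((b :+ :1 :+ con (ℤ.+ 0)) :* f :- a :* g) :- (:1 :+ con (ℤ.+ 0)) :* f)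
    refl a b (f 0) (f 1)
  Θ-lower-b (suc n) a b f = linear₂ (b + fromℕ (suc n)) (- a)
    (Θ-lower-b n a b f) (Θ-lower-b n (a + 1#) (b + 1#) (f ∘ suc))
    (solve 8 (λ a b m t t₁ s s₁ r →
       (b :+ (:1 :+ m)) :* t :- a :* s
       := ((b :+ :1 :+ (:1 :+ m)) :* ((b :+ :1 :+ m) :* t₁ :- a :* r) :- a :* s₁)
            :- (:1 :+ (:1 :+ m)) :* ((b :+ :1 :+ m) :* t₁ :- a :* r)
          :+ (b :+ (:1 :+ m)) :* (t :- (((b :+ :1 :+ m) :* t₁ :- a :* r) :- (:1 :+ m) :* t₁))
          :+ :- a :* (s :- (s₁ :- (:1 :+ m) :* r)))
       refl a b (fromℕ n) (Θ (suc n) a b f) (Θ n a (b + 1#) f)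
       (Θ (suc n) (a + 1#) (b + 1#) (f ∘ suc)) (Θ (suc n) (a + 1#) (b + 1# + 1#) (f ∘ suc))
       (Θ n (a + 1#) (b + 1# + 1#) (f ∘ suc)))

  -- Termwise this is `(b+k) (b+1+k)ₙ₋ₖ = (b+k)ₙ₋ₖ (b+n)`.
  Θ-raise-b : ∀ n a b g →
    Θ n a (b + 1#) (λ k → (b + fromℕ k) * g k) ≈ (b + fromℕ n) * Θ n a b g
  Θ-raise-b zero    a b g = refl
  Θ-raise-b (suc n) a b g = linear₂ (b + 1# + fromℕ n) (- a)
    (Θ-raise-b n a b g)
    (trans (Θ-cong n refl refl (λ k _ → *-congʳ (sym (+-assoc b 1# (fromℕ k)))))
           (Θ-raise-b n (a + 1#) (b + 1#) (g ∘ suc)))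
    (solve 7 (λ a b m t s x y →
       (b :+ :1 :+ m) :* t :- a :* s
       := (b :+ (:1 :+ m)) :* ((b :+ m) :* x :- a :* y)
          :+ (b :+ :1 :+ m) :* (t :- (b :+ m) :* x)
          :+ :- a :* (s :- (b :+ :1 :+ m) :* y))
       refl a b (fromℕ n) _ _ (Θ n a b g) (Θ n (a + 1#) (b + 1#) (g ∘ suc)))

  -- Split `n+1 = k + (n+1-k)` in each term and absorb the second part by
  -- `(n+1-k) C(n+1,k) = (n+1) C(n,k)`.
  Θ-lower-n : ∀ n a b g →
    fromℕ (suc n) * Θ (suc n) a b g
    ≈ Θ (suc n) a b (λ k → fromℕ k * g k) + fromℕ (suc n) * (b + fromℕ n) * Θ n a b g
  Θ-lower-n zero a b g = solve 4 (λ a b f g →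
      (:1 :+ con (ℤ.+ 0)) :* ((b :+ con (ℤ.+ 0)) :* f :- a :* g)
      := ((b :+ con (ℤ.+ 0)) :* (con (ℤ.+ 0) :* f) :- a :* ((:1 :+ con (ℤ.+ 0)) :* g))
         :+ (:1 :+ con (ℤ.+ 0)) :* (b :+ con (ℤ.+ 0)) :* f)
    refl a b (g 0) (g 1)
  Θ-lower-n (suc n) a b g = linear₃ (b + fromℕ (suc n)) (- a) a
    (Θ-lower-n n a b g) (Θ-lower-n n (a + 1#) (b + 1#) (g ∘ suc))
    (trans (Θ-cong (suc n) refl refl (λ k _ →
              solve 2 (λ k g → (:1 :+ k) :* g := :1 :* g :+ k :* g) refl (fromℕ k) (g (suc k))))
           (Θ-linear (suc n) (a + 1#) (b + 1#) 1# (g ∘ suc) (λ k → fromℕ k * g (suc k))))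
    (solve 9 (λ a b m y y′ x′ kx ksx kx′ →
       (:1 :+ (:1 :+ m)) :* ((b :+ (:1 :+ m)) :* ((b :+ m) :* y :- a :* y′) :- a :* x′)
       := ((b :+ (:1 :+ m)) :* kx :- a :* ksx)
          :+ (:1 :+ (:1 :+ m)) :* (b :+ (:1 :+ m)) :* ((b :+ m) :* y :- a :* y′)
          :+ (b :+ (:1 :+ m)) :* ((:1 :+ m) :* ((b :+ m) :* y :- a :* y′)
               :- (kx :+ (:1 :+ m) :* (b :+ m) :* y))
          :+ :- a :* ((:1 :+ m) :* x′ :- (kx′ :+ (:1 :+ m) :* (b :+ :1 :+ m) :* y′))
          :+ a :* (ksx :- (:1 :* x′ :+ kx′)))
       refl a b (fromℕ n) (Θ n a b g) (Θ n (a + 1#) (b + 1#) (g ∘ suc))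
       (Θ (suc n) (a + 1#) (b + 1#) (g ∘ suc)) _ _ _)

  -- A well-poised sum of Dixon type.

  module Dixon (c : Carrier) (f : ℕ → Carrier) where

    -- Here f(k) = 1/(c+k), so that D is well-poised: its parameters are 2c, c, -n over
    -- c+1, 2c+n+1.
    D E : ℕ → Carrier
    D n = Θ n (c + c) (c + c + fromℕ n + 1#) f
    E n = Θ n (c + c) (c + c + fromℕ n + 1# + 1#) f

    Inverts : ℕ → Set _
    Inverts n = ∀ k → k ≤ n → (c + fromℕ k) * f k ≈ 1#

    Θ-one-offset : ∀ n e → Θ n (c + c) (c + c + e) (λ _ → 1#) ≈ poch e n
    Θ-one-offset n e = trans (Θ-one n (c + c) (c + c + e)) (poch-cong n
      (solve 2 (λ a e → (a :+ e) :- a := e) refl (c + c) e))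

    -- Put `b = 2c+n+1`. By `Θ-raise-b`, weighting the terms of `E n` with `b+k` gives `(b+n) D n`.
    -- Since `(b+k) f(k) = (b-c) f(k) + 1`, the weighted sum is also `(b-c) E n` plus a
    -- Chu-Vandermonde sum.
    E≈D : ∀ n → Inverts n →
      (c + fromℕ n + 1#) * E n
      ≈ (c + c + fromℕ n + fromℕ n + 1#) * D n - poch (fromℕ n + 1# + 1#) n
    E≈D n inv = linear₃ 1# (- 1#) (- 1#)
      (Θ-raise-b n (c + c) b f)
      (trans (Θ-cong n refl refl λ k k≤n → linear₁ 1# (inv k k≤n)
               (solve 4 (λ c b k f → (b :+ k) :* f
                  := (b :- c) :* f :+ :1 :+ :1 :* ((c :+ k) :* f :- :1)) refl c b (fromℕ k) (f k)))
             (Θ-linear n (c + c) (b + 1#) (b - c) f (λ _ → 1#)))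
      (trans (Θ-congᵇ n _ (solve 2 (λ c m → c :+ c :+ m :+ :1 :+ :1 := c :+ c :+ (m :+ :1 :+ :1)) refl c (fromℕ n)))
             (Θ-one-offset n (fromℕ n + 1# + 1#)))
      (solve 7 (λ c m e d x o p →
         (c :+ m :+ :1) :* e
         := (c :+ c :+ m :+ m :+ :1) :* d :- p
            :+ :1 :* (x :- ((c :+ c :+ m :+ :1) :+ m) :* d)
            :+ :- :1 :* (x :- (((c :+ c :+ m :+ :1) :- c) :* e :+ o))
            :+ :- :1 :* (o :- p))
         refl c (fromℕ n) (E n) (D n) _ _ (poch (fromℕ n + 1# + 1#) n))
      where b = c + c + fromℕ n + 1#

    -- The contributions of Θ-one cancel, which makes D a product.
    D-suc : ∀ n → Inverts (suc n) →
      (c + fromℕ n + 1#) * D (suc n)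
      ≈ fromℕ 2 * fromℕ (suc n) * (c + c + fromℕ n + fromℕ n + 1#) * D n
    D-suc n inv = linear₂ 1# 1#
      (Θ-lower-n n (c + c) b f)
      (trans (Θ-cong (suc n) refl refl λ k k≤n → linear₁ 1# (inv k k≤n)
               (solve 3 (λ c k f → k :* f := (:- c) :* f :+ :1 :+ :1 :* ((c :+ k) :* f :- :1))
                  refl c (fromℕ k) (f k)))
             (Θ-linear (suc n) (c + c) b (- c) f (λ _ → 1#)))
      (linear₃ 1# (fromℕ (suc n) * (b + fromℕ n)) (fromℕ 2 * fromℕ (suc n))
      (trans (Θ-congᵇ (suc n) _ (solve 2 (λ c m → c :+ c :+ (:1 :+ m) :+ :1 := c :+ c :+ (m :+ :1 :+ :1)) refl c (fromℕ n)))
             (Θ-one-offset (suc n) (fromℕ n + 1# + 1#)))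
      -- The second parameter of `D` moves with `n`, so the shorter sum left by `Θ-lower-n` is
      -- `E n`, not `D n`. Its coefficient contains `b+n = 2(c+n+1)`, the factor that `E≈D` needs.
      (Θ-congᵇ n f (solve 2 (λ c m → c :+ c :+ (:1 :+ m) :+ :1 := c :+ c :+ m :+ :1 :+ :1) refl c (fromℕ n)))
      (E≈D n (λ k k≤n → inv k (ℕₚ.m≤n⇒m≤1+n k≤n)))
      (solve 9 (λ c m d′ x y o e d p →
         let b = c :+ c :+ (:1 :+ m) :+ :1
             n = :1 :+ m in
         (c :+ m :+ :1) :* d′
         := :ℕ 2 :* n :* (c :+ c :+ m :+ m :+ :1) :* d
            :+ :1 :* (n :* d′ :- (x :+ n :* (b :+ m) :* y))
            :+ :1 :* (x :- (:- c :* d′ :+ o))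
            :+ :1 :* (o :- p :* ((m :+ :1 :+ :1) :+ m))
            :+ n :* (b :+ m) :* (y :- e)
            :+ :ℕ 2 :* n :* ((c :+ m :+ :1) :* e :- ((c :+ c :+ m :+ m :+ :1) :* d :- p)))
         refl c (fromℕ n) (D (suc n)) _ _ _ (E n) (D n) (poch (fromℕ n + 1# + 1#) n)))
      where b = c + c + fromℕ (suc n) + 1#

    -- The recurrence for sums of a sequence with difference `f`.

    module Difference (h : ℕ → Carrier) where

      a : Carrier
      a = c + c - 1#

      -- With 2 U alone the recurrence has a further term in D; adding a D removes it.
      U W : ℕ → Carrier
      U m = Θ (suc m) a (a + fromℕ (suc m)) h
      W m = fromℕ 2 * U m + a * D m

      HasDifference : ℕ → Set _
      HasDifference n = ∀ k → k ≤ n → h (suc k) ≈ h k + f k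

      -- With `n = m+1`, `U-suc` leaves `2 n a E m - a D (suc m)` beside `W m`. After multiplication
      -- by `c+n`, `E≈D` and `D-suc` give both the same multiple of `D m`; these cancel, and only
      -- the Chu-Vandermonde value of `E≈D` survives.
      W-suc : ∀ m → Inverts (suc m) → HasDifference (suc m) →
        (c + fromℕ m + 1#) * W (suc m)
        ≈ fromℕ 2 * (fromℕ 2 * fromℕ (suc m) + 1#) * ((c + fromℕ m + 1#) * W m)
          - fromℕ 2 * a * (fromℕ (suc m) * poch (fromℕ m + 1# + 1#) m)
      W-suc m inv diff = linear₃ (fromℕ 2 * (c + fromℕ m + 1#)) (fromℕ 2 * n * a) (- a)
        U-suc (E≈D m inv′) (D-suc m inv)
        (solve 8 (λ c m u u′ d d′ e p →
           let n = :1 :+ m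
               a = c :+ c :- :1
               c+n = c :+ m :+ :1
               2c+ = c :+ c :+ m :+ m :+ :1 in
           c+n :* (:ℕ 2 :* u′ :+ a :* d′)
           := :ℕ 2 :* (:ℕ 2 :* n :+ :1) :* (c+n :* (:ℕ 2 :* u :+ a :* d)) :- :ℕ 2 :* a :* (n :* p)
              :+ :ℕ 2 :* c+n :* (u′ :- ((:ℕ 2 :* n :+ :1) :* (:ℕ 2 :* u :+ a :* d) :+ n :* a :* e :- a :* d′))
              :+ :ℕ 2 :* n :* a :* (c+n :* e :- (2c+ :* d :- p))
              :+ :- a :* (c+n :* d′ :- :ℕ 2 :* n :* 2c+ :* d))
           refl c (fromℕ m) (U m) (U (suc m)) (D m) (D (suc m)) (E m) (poch (fromℕ m + 1# + 1#) m))
        where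
        n b : Carrier
        n = fromℕ (suc m)
        b = a + n

        inv′ : Inverts m
        inv′ k k≤m = inv k (ℕₚ.m≤n⇒m≤1+n k≤m)

        diff′ : HasDifference m
        diff′ k k≤m = diff k (ℕₚ.m≤n⇒m≤1+n k≤m)

        1+a : a + 1# ≈ c + c
        1+a = solve 1 (λ c → c :+ c :- :1 :+ :1 := c :+ c) refl c

        Θ≈D : Θ m (a + 1#) (b + 1#) f ≈ D m
        Θ≈D = Θ-cong m 1+a
          (solve 2 (λ c m → c :+ c :- :1 :+ (:1 :+ m) :+ :1 := c :+ c :+ m :+ :1) refl c (fromℕ m))
          (λ _ _ → refl)

        Θ≈E : Θ m (a + 1#) (b + 1# + 1#) f ≈ E m
        Θ≈E = Θ-cong m 1+a
          (solve 2 (λ c m → c :+ c :- :1 :+ (:1 :+ m) :+ :1 :+ :1 := c :+ c :+ m :+ :1 :+ :1) refl c (fromℕ m))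
          (λ _ _ → refl)

        -- Because `b - a = n`, `Θ-difference` and `Θ-lower-b` contain `n Θ m a (b+1) h` with
        -- opposite signs, and adding them eliminates it. Hence `W m` is `U m` with `b` raised by
        -- one.
        U₁ : Θ (suc m) a (b + 1#) h ≈ fromℕ 2 * U m + a * D m
        U₁ = linear₃ (- 1#) (- 1#) a
          (Θ-difference m a b h f diff′) (Θ-lower-b m a b h) Θ≈D
          (solve 7 (λ a n u p r t d →
             p := :ℕ 2 :* u :+ a :* d
               :+ :- :1 :* (u :- (((a :+ n) :- a) :* r :- a :* t))
               :+ :- :1 :* (u :- (p :- n :* r))
               :+ a :* (t :- d))
             refl a n (U m) _ (Θ m a (b + 1#) h) _ (D m))

        -- The same elimination one step higher: now the gap is `n+1`, so the two relations are
        -- combined with weights `n` and `n+1`.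
        U₂ : fromℕ (suc (suc m)) * Θ (suc m) a (b + 1# + 1#) h
             ≈ (fromℕ 2 * n + 1#) * Θ (suc m) a (b + 1#) h + n * a * E m
        U₂ = linear₃ (- n) (- (1# + n)) (n * a)
          (Θ-difference m a (b + 1#) h f diff′) (Θ-lower-b m a (b + 1#) h) Θ≈E
          (solve 7 (λ a n q p s t e →
             (:1 :+ n) :* q := (:ℕ 2 :* n :+ :1) :* p :+ n :* a :* e
               :+ :- n :* (p :- (((a :+ n :+ :1) :- a) :* s :- a :* t))
               :+ :- (:1 :+ n) :* (p :- (q :- n :* s))
               :+ n :* a :* (t :- e))
             refl a n (Θ (suc m) a (b + 1# + 1#) h) (Θ (suc m) a (b + 1#) h)
             (Θ m a (b + 1# + 1#) h) _ (E m))

        Θ≈D′ : Θ (suc m) (a + 1#) (a + (1# + n) + 1#) f ≈ D (suc m)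
        Θ≈D′ = Θ-cong (suc m) 1+a
          (solve 2 (λ c n → c :+ c :- :1 :+ (:1 :+ n) :+ :1 := c :+ c :+ n :+ :1) refl c n)
          (λ _ _ → refl)

        -- `Θ-difference` shortens the sum but raises its second parameter to `b+2`; `U₂` and `U₁`
        -- lead back to `b`.
        U-suc : U (suc m) ≈ (fromℕ 2 * n + 1#) * (fromℕ 2 * U m + a * D m) + n * a * E m - a * D (suc m)
        U-suc = linear₂ 1# (- a)
          (Θ-difference (suc m) a (a + (1# + n)) h f diff) Θ≈D′
          (linear₃ (1# + n) 1# (fromℕ 2 * n + 1#)
            (Θ-congᵇ (suc m) h (solve 2 (λ a n → a :+ (:1 :+ n) :+ :1 := a :+ n :+ :1 :+ :1) refl a n))
            U₂ U₁
            (solve 10 (λ a n u′ x y d′ q p e w →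
               u′ := (:ℕ 2 :* n :+ :1) :* w :+ n :* a :* e :- a :* d′
                 :+ :1 :* (u′ :- (((a :+ (:1 :+ n)) :- a) :* x :- a :* y))
                 :+ :- a :* (y :- d′)
                 :+ (:1 :+ n) :* (x :- q)
                 :+ :1 :* ((:1 :+ n) :* q :- ((:ℕ 2 :* n :+ :1) :* p :+ n :* a :* e))
                 :+ (:ℕ 2 :* n :+ :1) :* (p :- w))
               refl a n (U (suc m)) _ _ (D (suc m)) (Θ (suc m) a (b + 1# + 1#) h)
               (Θ (suc m) a (b + 1#) h) (E m) (W m)))

-- Factorials and binomials over a field of characteristic zero.

module Field {c ℓ} (F : CharZeroField c ℓ) where
  open CharZeroField F hiding (zero)
  open FieldNotation F
  open IntegerSolver commutativeRing
  open Contiguous commutativeRing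
  open import Relation.Binary.Reasoning.Setoid setoid

  fromℕ-+ : ∀ m n → fromℕ (m ℕ.+ n) ≈ fromℕ m + fromℕ n
  fromℕ-+ zero    n = sym (+-identityˡ _)
  fromℕ-+ (suc m) n = trans (+-congˡ (fromℕ-+ m n)) (sym (+-assoc _ _ _))

  fromℕ-* : ∀ m n → fromℕ (m ℕ.* n) ≈ fromℕ m * fromℕ n
  fromℕ-* zero    n = sym (zeroˡ _)
  fromℕ-* (suc m) n = begin
    fromℕ (n ℕ.+ m ℕ.* n)           ≈⟨ fromℕ-+ n (m ℕ.* n) ⟩
    fromℕ n + fromℕ (m ℕ.* n)       ≈⟨ +-congˡ (fromℕ-* m n) ⟩
    fromℕ n + fromℕ m * fromℕ n     ≈⟨ solve 2 (λ m n → n :+ m :* n := (:1 :+ m) :* n) refl (fromℕ m) (fromℕ n) ⟩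
    (1# + fromℕ m) * fromℕ n        ∎

  fromℕ≉0 : ∀ n → .{{NonZero n}} → ¬ (fromℕ n ≈ 0#)
  fromℕ≉0 (suc n) = charZero n

  fromℕ-inverse : ∀ n → .{{NonZero n}} → fromℕ n * fromℕ n ⁻¹ ≈ 1#
  fromℕ-inverse n = inverseʳ _ (fromℕ≉0 n)

  factorial-inverse : ∀ t → fromℕ (t !) * fromℕ (t !) ⁻¹ ≈ 1#
  factorial-inverse t = fromℕ-inverse (t !) {{t ℕₚ.!≢0}}

  *-cancelˡ-≉0 : ∀ {u p q} → ¬ (u ≈ 0#) → u * p ≈ u * q → p ≈ q
  *-cancelˡ-≉0 {u} {p} {q} u≉0 up≈uq = linear₂ (u ⁻¹) (q - p) up≈uq (inverseʳ u u≉0)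
    (solve 4 (λ u i p q → p := q :+ i :* (u :* p :- u :* q) :+ (q :- p) :* (u :* i :- :1))
       refl u (u ⁻¹) p q)

  *-≉0ˡ : ∀ {u v} → ¬ (u * v ≈ 0#) → ¬ (u ≈ 0#)
  *-≉0ˡ uv≉0 u≈0 = uv≉0 (trans (*-congʳ u≈0) (zeroˡ _))

  *-≉0 : ∀ {u v} → ¬ (u ≈ 0#) → ¬ (v ≈ 0#) → ¬ (u * v ≈ 0#)
  *-≉0 u≉0 v≉0 uv≈0 = v≉0 (*-cancelˡ-≉0 u≉0 (trans uv≈0 (sym (zeroʳ _))))

  ≉0-resp : ∀ {u v} → u ≈ v → ¬ (u ≈ 0#) → ¬ (v ≈ 0#)
  ≉0-resp u≈v u≉0 v≈0 = u≉0 (trans u≈v v≈0)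

  falling-cong : ∀ {z w} t → z ≈ w → falling z t ≈ falling w t
  falling-cong zero    z≈w = refl
  falling-cong (suc t) z≈w = *-cong (falling-cong t z≈w) (+-congʳ z≈w)

  falling-suc : ∀ z t → falling (1# + z) (suc t) ≈ (1# + z) * falling z t
  falling-suc z zero    =
    solve 1 (λ z → :1 :* (:1 :+ z :- con (ℤ.+ 0)) := (:1 :+ z) :* :1) refl z
  falling-suc z (suc t) = linear₁ (z - fromℕ t) (falling-suc z t)
    (solve 4 (λ z t p q → p :* (:1 :+ z :- (:1 :+ t))
       := (:1 :+ z) :* (q :* (z :- t)) :+ (z :- t) :* (p :- (:1 :+ z) :* q))
       refl z (fromℕ t) (falling (1# + z) (suc t)) (falling z t))

  falling≈poch : ∀ z t → falling (z + fromℕ t) t ≈ poch (z + 1#) t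
  falling≈poch z zero    = refl
  falling≈poch z (suc t) = begin
    falling (z + (1# + fromℕ t)) (suc t)    ≈⟨ falling-cong (suc t) z+1+t ⟩
    falling (1# + (z + fromℕ t)) (suc t)    ≈⟨ falling-suc (z + fromℕ t) t ⟩
    (1# + (z + fromℕ t)) * falling (z + fromℕ t) t ≈⟨ *-congˡ (falling≈poch z t) ⟩
    (1# + (z + fromℕ t)) * poch (z + 1#) t
      ≈⟨ solve 3 (λ z t p → (:1 :+ (z :+ t)) :* p := p :* (z :+ :1 :+ t)) refl z (fromℕ t) _ ⟩
    poch (z + 1#) t * (z + 1# + fromℕ t)    ∎
    where
    z+1+t = solve 2 (λ z t → z :+ (:1 :+ t) := :1 :+ (z :+ t)) refl z (fromℕ t)

  poch-split : ∀ z k l → poch z (k ℕ.+ l) ≈ poch z k * poch (z + fromℕ k) l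
  poch-split z zero    l = trans (poch-cong l (sym (+-identityʳ z))) (sym (*-identityˡ _))
  poch-split z (suc k) l = begin
    poch z (suc (k ℕ.+ l))                              ≈⟨ poch-suc z (k ℕ.+ l) ⟩
    z * poch (z + 1#) (k ℕ.+ l)                         ≈⟨ *-congˡ (poch-split (z + 1#) k l) ⟩
    z * (poch (z + 1#) k * poch (z + 1# + fromℕ k) l)   ≈⟨ *-assoc _ _ _ ⟨
    z * poch (z + 1#) k * poch (z + 1# + fromℕ k) l
      ≈⟨ *-cong (sym (poch-suc z k)) (poch-cong l (+-assoc z 1# (fromℕ k))) ⟩
    poch z (suc k) * poch (z + fromℕ (suc k)) l         ∎

  1/t!≈ : ∀ t → fromℕ (t !) ⁻¹ ≈ fromℕ (suc t) * fromℕ (suc t !) ⁻¹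
  1/t!≈ t = linear₃ (- (fromℕ (t !) ⁻¹)) (fromℕ (suc t) * fromℕ (suc t !) ⁻¹)
    (fromℕ (t !) ⁻¹ * fromℕ (suc t !) ⁻¹)
    (factorial-inverse (suc t)) (factorial-inverse t) (fromℕ-* (suc t) (t !))
    (solve 5 (λ n f f′ i i′ → i := n :* i′ :+ :- i :* (f′ :* i′ :- :1)
         :+ n :* i′ :* (f :* i :- :1) :+ i :* i′ :* (f′ :- n :* f))
       refl (fromℕ (suc t)) (fromℕ (t !)) (fromℕ (suc t !)) (fromℕ (t !) ⁻¹) (fromℕ (suc t !) ⁻¹))

  -- The left numerator is `(1+z) falling z t`; split `1+z = (t+1) + (z-t)` and absorb `t+1` into
  -- the factorial.
  binom-pascal : ∀ z t → binom (1# + z) (suc t) ≈ binom z t + binom z (suc t)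
  binom-pascal z t = linear₂ (fromℕ (suc t !) ⁻¹) (- falling z t)
    (falling-suc z t) (1/t!≈ t)
    (solve 6 (λ z t p q i i′ → p :* i′ := q :* i :+ q :* (z :- t) :* i′
       :+ i′ :* (p :- (:1 :+ z) :* q) :+ :- q :* (i :- (:1 :+ t) :* i′))
       refl z (fromℕ t) _ (falling z t) _ _)

  binom-above : ∀ n → binom (fromℕ n) (suc n) ≈ 0#
  binom-above n = solve 3 (λ n p i → p :* (n :- n) :* i := con (ℤ.+ 0)) refl (fromℕ n) _ _

  -- Finite sums and the explicit form of `Θ`.

  sumTo-cong : ∀ n {f g} → (∀ k → k ≤ n → f k ≈ g k) → sumTo n f ≈ sumTo n g
  sumTo-cong zero    f≈g = f≈g 0 z≤n
  sumTo-cong (suc n) f≈g =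
    +-cong (sumTo-cong n (λ k k≤n → f≈g k (ℕₚ.m≤n⇒m≤1+n k≤n))) (f≈g (suc n) ℕₚ.≤-refl)

  sumTo-first : ∀ n f → sumTo (suc n) f ≈ f 0 + sumTo n (f ∘ suc)
  sumTo-first zero    f = refl
  sumTo-first (suc n) f = trans (+-congʳ (sumTo-first n f)) (+-assoc _ _ _)

  sumTo-linear : ∀ n s f g → sumTo n (λ k → f k + s * g k) ≈ sumTo n f + s * sumTo n g
  sumTo-linear zero    s f g = refl
  sumTo-linear (suc n) s f g = linear₁ 1# (sumTo-linear n s f g)
    (solve 6 (λ s u x y p q → u :+ (p :+ s :* q) := x :+ p :+ s :* (y :+ q)
       :+ :1 :* (u :- (x :+ s :* y))) refl s _ (sumTo n f) (sumTo n g) (f (suc n)) (g (suc n)))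

  sumTo-scale : ∀ n s f → sumTo n (λ k → s * f k) ≈ s * sumTo n f
  sumTo-scale zero    s f = refl
  sumTo-scale (suc n) s f = trans (+-congʳ (sumTo-scale n s f)) (sym (distribˡ s _ _))

  Θ-term : ℕ → Carrier → Carrier → (ℕ → Carrier) → ℕ → Carrier
  Θ-term n a b f k =
    pow (- 1#) k * binom (fromℕ n) k * (poch a k * poch (b + fromℕ k) (n ∸ k)) * f k

  Θ≈sum : ∀ n a b f → Θ n a b f ≈ sumTo n (Θ-term n a b f)
  Θ≈sum zero    a b f = sym (linear₁ (f 0) (factorial-inverse 0)
    (solve 2 (λ f i → :1 :* (:1 :* i) :* (:1 :* :1) :* f
       := f :+ f :* ((:1 :+ con (ℤ.+ 0)) :* i :- :1)) refl (f 0) _))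
  Θ≈sum (suc n) a b f = sym (begin
    sumTo (suc n) (Θ-term (suc n) a b f)
      ≈⟨ sumTo-first n _ ⟩
    p 0 + sumTo n (λ k → Θ-term (suc n) a b f (suc k))
      ≈⟨ +-congˡ (sumTo-cong n (λ k _ → pascal k)) ⟩
    p 0 + sumTo n (λ k → p (suc k) + - a * q k)
      ≈⟨ +-congˡ (sumTo-linear n (- a) (p ∘ suc) q) ⟩
    p 0 + (sumTo n (p ∘ suc) + - a * sumTo n q)
      ≈⟨ +-assoc _ _ _ ⟨
    p 0 + sumTo n (p ∘ suc) + - a * sumTo n q
      ≈⟨ +-congʳ (sumTo-first n p) ⟨
    sumTo n p + p (suc n) + - a * sumTo n q
      -- The surplus term `p (suc n)` carries `C(n,n+1)`, whose numerator ends in the factor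
      -- `n - n`.
      ≈⟨ +-congʳ (trans (+-congˡ p-last) (+-identityʳ _)) ⟩
    sumTo n p + - a * sumTo n q
      ≈⟨ +-congʳ (trans (sumTo-cong n p≈) (sumTo-scale n (b + fromℕ n) _)) ⟩
    (b + fromℕ n) * sumTo n (Θ-term n a b f) + - a * sumTo n q
      ≈⟨ +-cong (*-congˡ (sym (Θ≈sum n a b f))) (*-congˡ (sym (Θ≈sum n (a + 1#) (b + 1#) (f ∘ suc)))) ⟩
    (b + fromℕ n) * Θ n a b f + - a * Θ n (a + 1#) (b + 1#) (f ∘ suc)
      ≈⟨ solve 3 (λ a x y → x :+ :- a :* y := x :- a :* y) refl a _ _ ⟩
    Θ (suc n) a b f ∎)
    where
    -- The two halves of Pascal's rule: `p` has `C(n,k)` but still the long product `(b+k)ₙ₊₁₋ₖ`,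
    -- and `q` is the half shifted by one.
    p q : ℕ → Carrier
    p k = pow (- 1#) k * binom (fromℕ n) k * (poch a k * poch (b + fromℕ k) (suc n ∸ k)) * f k
    q = Θ-term n (a + 1#) (b + 1#) (f ∘ suc)

    pascal : ∀ k → Θ-term (suc n) a b f (suc k) ≈ p (suc k) + - a * q k
    pascal k = linear₃ (- x * (P′ * r) * f (suc k)) (- x * C * r * f (suc k))
        (a * x * C * P * f (suc k))
      (binom-pascal (fromℕ n) k) (poch-suc a k)
      (poch-cong (n ∸ k) (+-assoc b 1# (fromℕ k)))
      (solve 10 (λ a x B C C′ P P′ r r′ f →
         x :* :- :1 :* B :* (P′ :* r) :* f
         := x :* :- :1 :* C′ :* (P′ :* r) :* f :+ :- a :* (x :* C :* (P :* r′) :* f)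
            :+ :- x :* (P′ :* r) :* f :* (B :- (C :+ C′))
            :+ :- x :* C :* r :* f :* (P′ :- a :* P)
            :+ a :* x :* C :* P :* f :* (r′ :- r))
         refl a x (binom (fromℕ (suc n)) (suc k)) C (binom (fromℕ n) (suc k)) P P′ r
         (poch (b + 1# + fromℕ k) (n ∸ k)) (f (suc k)))
      where
      x C P P′ r : Carrier
      x = pow (- 1#) k
      C = binom (fromℕ n) k
      P = poch (a + 1#) k
      P′ = poch a (suc k)
      r = poch (b + fromℕ (suc k)) (n ∸ k)

    p-last : p (suc n) ≈ 0#
    p-last = linear₁ (pow (- 1#) (suc n) * y * f (suc n)) (binom-above n)
      (solve 4 (λ x C y f → x :* C :* y :* f := con (ℤ.+ 0) :+ x :* y :* f :* (C :- con (ℤ.+ 0)))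
         refl _ _ y _)
      where y = poch a (suc n) * poch (b + fromℕ (suc n)) (suc n ∸ suc n)

    p≈ : ∀ k → k ≤ n → p k ≈ (b + fromℕ n) * Θ-term n a b f k
    p≈ k k≤n = begin
      x * (poch a k * poch (b + fromℕ k) (suc n ∸ k)) * f k
        -- Only for `k ≤ n` is the truncated `suc n ∸ k` a successor; this exposes the top factor
        -- `b + k + (n-k) = b + n`.
        ≡⟨ ≡.cong (λ l → x * (poch a k * poch (b + fromℕ k) l) * f k) (ℕₚ.+-∸-assoc 1 k≤n) ⟩
      x * (poch a k * (r * (b + fromℕ k + fromℕ (n ∸ k)))) * f k
        ≈⟨ linear₁ (x * poch a k * r * f k)
             (trans (sym (fromℕ-+ k (n ∸ k))) (reflexive (≡.cong fromℕ (ℕₚ.m+[n∸m]≡n k≤n))))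
             (solve 8 (λ x P r f b k l n → x :* (P :* (r :* (b :+ k :+ l))) :* f
                := (b :+ n) :* (x :* (P :* r) :* f) :+ x :* P :* r :* f :* (k :+ l :- n))
                refl x (poch a k) r (f k) b (fromℕ k) (fromℕ (n ∸ k)) (fromℕ n)) ⟩
      (b + fromℕ n) * (x * (poch a k * r) * f k) ∎
      where
      x = pow (- 1#) k * binom (fromℕ n) k
      r = poch (b + fromℕ k) (n ∸ k)

  half : Carrier
  half = fromℕ 2 ⁻¹

  half-inverse : fromℕ 2 * half ≈ 1#
  half-inverse = fromℕ-inverse 2

  Harm-inverse : ∀ k → fromℕ (suc k) * (0# + fromℕ (suc k)) ⁻¹ ≈ 1#
  Harm-inverse k = trans (*-congˡ (⁻¹-cong (+-identityˡ _))) (fromℕ-inverse (suc k))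

  Harm-2+2n : ∀ n → Harm (2 ℕ.* suc n)
    ≈ Harm (2 ℕ.* n) + (0# + fromℕ (suc (2 ℕ.* n))) ⁻¹ + (0# + fromℕ (2 ℕ.+ 2 ℕ.* n)) ⁻¹
  Harm-2+2n n = reflexive (≡.cong Harm (ℕₚ.*-suc 2 n))

  -- Closed forms for harmonic numbers.

  module HarmonicSum (x : Carrier) where

    -- With `c = x+1`, `a` becomes `2x+1`, and the difference equation between `H k x` and `f` holds
    -- by definition of `H`.
    open Dixon (x + 1#) (λ k → (x + fromℕ (suc k)) ⁻¹)
    open Difference (λ k → H k x)

    Shifts≉0 : ℕ → Set _
    Shifts≉0 n = ∀ j → 1 ≤ j → j ≤ n → ¬ (x + fromℕ j ≈ 0#)

    inverts : ∀ m → Shifts≉0 (suc m) → Inverts m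
    inverts m ≉0 k k≤m = trans (*-congʳ (+-assoc x 1# (fromℕ k)))
      (inverseʳ _ (≉0 (suc k) (s≤s z≤n) (s≤s k≤m)))

    -- Here `n = m+1`. `A m` is `(2m+1)!/m!`, the Chu-Vandermonde term of `W-suc`; `S m` is the
    -- harmonic bracket of the theorem.
    A S : ℕ → Carrier
    A m = fromℕ (suc m) * poch (fromℕ m + 1# + 1#) m
    S m = H (suc m) x + Harm (suc m) - fromℕ 2 * Harm (2 ℕ.* suc m)

    A-suc : ∀ m → A (suc m) ≈ fromℕ 2 * (fromℕ 2 * fromℕ (suc m) + 1#) * A m
    A-suc m = linear₂ (- 1#) z
      (poch-suc z (suc m))
      (poch-cong (suc m) (solve 1 (λ m → :1 :+ m :+ :1 :+ :1 := m :+ :1 :+ :1 :+ :1) refl (fromℕ m)))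
      (solve 4 (λ m p r s →
         let z = m :+ :1 :+ :1
             n = :1 :+ m in
         (:1 :+ n) :* r := :ℕ 2 :* (:ℕ 2 :* n :+ :1) :* (n :* p)
           :+ :- :1 :* (p :* (z :+ m) :* (z :+ n) :- z :* s)
           :+ z :* (r :- s))
         refl (fromℕ m) (poch z m) (poch (fromℕ (suc m) + 1# + 1#) (suc m)) (poch (z + 1#) (suc m)))
      where z = fromℕ m + 1# + 1#

    -- In the increment of `S`, `1/(n+1)` cancels `2/(2n+2)`. What remains is `1/(x+n+1) - 2/(2n+1)
    -- = -a/((2n+1)(x+n+1))`, here multiplied out.
    S-suc : ∀ m → Shifts≉0 (suc (suc m)) →
      (fromℕ 2 * fromℕ (suc m) + 1#) * ((x + 1# + fromℕ m + 1#) * S (suc m))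
      ≈ (fromℕ 2 * fromℕ (suc m) + 1#) * ((x + 1# + fromℕ m + 1#) * S m) - a
    S-suc m ≉0 = linear₃ u (- (fromℕ 2 * v)) (u * v)
      (inverseʳ _ (≉0 (suc (suc m)) (s≤s z≤n) ℕₚ.≤-refl))
      (trans (*-congʳ (+-comm _ _)) (trans (*-congʳ (+-congˡ (sym 2n≈))) (Harm-inverse (2 ℕ.* suc m))))
      i₁≈2j₂
      (linear₁ (- (fromℕ 2 * u * v)) (Harm-2+2n (suc m))
        (solve 10 (λ x m hx h1 h2 i i₁ j₁ j₂ h2′ →
           let n = :1 :+ m
               u = :ℕ 2 :* n :+ :1
               v = x :+ :1 :+ m :+ :1 in
           u :* (v :* ((hx :+ i) :+ (h1 :+ i₁) :- :ℕ 2 :* h2′))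
           := u :* (v :* (hx :+ h1 :- :ℕ 2 :* h2)) :- ((x :+ :1) :+ (x :+ :1) :- :1)
              :+ u :* ((x :+ (:1 :+ n)) :* i :- :1)
              :+ :- (:ℕ 2 :* v) :* (u :* j₁ :- :1)
              :+ u :* v :* (i₁ :- :ℕ 2 :* j₂)
              :+ :- (:ℕ 2 :* u :* v) :* (h2′ :- (h2 :+ j₁ :+ j₂)))
           refl x (fromℕ m) (H (suc m) x) (Harm (suc m)) (Harm (2 ℕ.* suc m)) _ i₁ j₁ j₂
           (Harm (2 ℕ.* suc (suc m)))))
      where
      n u v i₁ j₁ j₂ : Carrier
      n = fromℕ (suc m)
      u = fromℕ 2 * n + 1#
      v = x + 1# + fromℕ m + 1#
      i₁ = (0# + fromℕ (suc (suc m))) ⁻¹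
      j₁ = (0# + fromℕ (suc (2 ℕ.* suc m))) ⁻¹
      j₂ = (0# + fromℕ (2 ℕ.+ 2 ℕ.* suc m)) ⁻¹

      2n≈ : fromℕ (2 ℕ.* suc m) ≈ fromℕ 2 * n
      2n≈ = fromℕ-* 2 (suc m)

      i₁≈2j₂ : i₁ ≈ fromℕ 2 * j₂
      i₁≈2j₂ = linear₃ (- i₁) (fromℕ 2 * j₂) (i₁ * j₂)
        (Harm-inverse (suc (2 ℕ.* suc m))) (Harm-inverse (suc m)) 2n≈
        (solve 4 (λ n N i j → i := :ℕ 2 :* j :+ :- i :* ((:1 :+ (:1 :+ N)) :* j :- :1)
             :+ :ℕ 2 :* j :* ((:1 :+ n) :* i :- :1) :+ i :* j :* (N :- :ℕ 2 :* n))
           refl n (fromℕ (2 ℕ.* suc m)) i₁ j₂)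

    -- Variation of constants: `A` solves the homogeneous part of `W-suc`, and the inhomogeneous
    -- term, a multiple of `A m`, is the increment of `S`.
    W≈ : ∀ m → Shifts≉0 (suc m) → W m ≈ A m * S m
    W≈ zero ≉0 = linear₃ (- fromℕ 2) 1# 1#
      (inverseʳ _ (≉0 1 ℕₚ.≤-refl ℕₚ.≤-refl)) (Harm-inverse 0) (Harm-inverse 1)
      (solve 4 (λ x i e₁ e₂ →
         let o = con (ℤ.+ 0)
             a = x :+ :1 :+ (x :+ :1) :- :1 in
         :ℕ 2 :* ((a :+ :ℕ 1 :+ o) :* o :- a :* (o :+ i)) :+ a :* i
         := :ℕ 1 :* :1 :* ((o :+ i) :+ (o :+ e₁) :- :ℕ 2 :* (o :+ e₁ :+ e₂))
            :+ :- :ℕ 2 :* ((x :+ :ℕ 1) :* i :- :1)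
            :+ :1 :* (:ℕ 1 :* e₁ :- :1) :+ :1 :* (:ℕ 2 :* e₂ :- :1))
         refl x _ _ _)
    W≈ (suc m) ≉0 = *-cancelˡ-≉0
      (≉0-resp (solve 2 (λ x m → x :+ (:1 :+ (:1 :+ m)) := x :+ :1 :+ m :+ :1) refl x (fromℕ m))
        (≉0 (suc (suc m)) (s≤s z≤n) ℕₚ.≤-refl))
      (linear₃ 1# (fromℕ 2 * u * v) (- (v * S (suc m)))
        (W-suc m (inverts (suc m) ≉0) (λ _ _ → refl))
        (W≈ m (λ j 1≤j j≤ → ≉0 j 1≤j (ℕₚ.m≤n⇒m≤1+n j≤)))
        (A-suc m)
        (linear₁ (- (fromℕ 2 * A m)) (S-suc m ≉0)
          (solve 9 (λ a u v w w′ A A′ s s′ →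
             v :* w′ := v :* (A′ :* s′)
               :+ :1 :* (v :* w′ :- (:ℕ 2 :* u :* (v :* w) :- :ℕ 2 :* a :* A))
               :+ :ℕ 2 :* u :* v :* (w :- A :* s)
               :+ :- (v :* s′) :* (A′ :- :ℕ 2 :* u :* A)
               :+ :- (:ℕ 2 :* A) :* (u :* (v :* s′) :- (u :* (v :* s) :- a)))
             refl a u v (W m) (W (suc m)) (A m) (A (suc m)) (S m) (S (suc m)))))
      where
      u v : Carrier
      u = fromℕ 2 * fromℕ (suc m) + 1#
      v = x + 1# + fromℕ m + 1#

    -- Each step adds the top factor `n + 1/2` to the falling product, and `4 (n + 1/2) = 2 (2n+1)`
    -- is the ratio in `A-suc`.
    A≈falling : ∀ m →
      A m ≈ fromℕ 2 * fromℕ (4 ^ m) * falling (fromℕ (suc m) - half) (suc m)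
    A≈falling zero = linear₁ (fromℕ 1) half-inverse
      (solve 1 (λ h → :ℕ 1 :* :1 := :ℕ 2 :* :ℕ 1 :* (:1 :* (:ℕ 1 :- h :- con (ℤ.+ 0)))
         :+ :ℕ 1 :* (:ℕ 2 :* h :- :1)) refl half)
    A≈falling (suc m) = linear₃ 1# (fromℕ 2 * (fromℕ 2 * n + 1#)) (- (fromℕ 2 * φ′))
      (A-suc m) (A≈falling m) (fromℕ-* 4 (4 ^ m))
      (linear₂ (- (fromℕ 2 * (fromℕ 4 * q))) (fromℕ 4 * q * φ)
        (trans (falling-cong (suc (suc m)) (+-assoc 1# n (- half))) (falling-suc (n - half) (suc m)))
        half-inverse
        (solve 8 (λ n h q q′ φ φ′ A A′ →
           A′ := :ℕ 2 :* q′ :* φ′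
             :+ :1 :* (A′ :- :ℕ 2 :* (:ℕ 2 :* n :+ :1) :* A)
             :+ :ℕ 2 :* (:ℕ 2 :* n :+ :1) :* (A :- :ℕ 2 :* q :* φ)
             :+ :- (:ℕ 2 :* φ′) :* (q′ :- :ℕ 4 :* q)
             :+ :- (:ℕ 2 :* (:ℕ 4 :* q)) :* (φ′ :- (:1 :+ (n :- h)) :* φ)
             :+ :ℕ 4 :* q :* φ :* (:ℕ 2 :* h :- :1))
           refl n half q q′ φ φ′ (A m) (A (suc m))))
      where
      n q q′ φ φ′ : Carrier
      n = fromℕ (suc m)
      q = fromℕ (4 ^ m)
      q′ = fromℕ (4 ^ suc m)
      φ = falling (n - half) (suc m)
      φ′ = falling (1# + n - half) (suc (suc m))

    -- `D-suc` multiplies `D` by `4 n (x+n+1/2)/(x+n+1)`, extending both falling products at the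
    -- top. The prefactor `a = 2 (x + 1/2)` supplies the lowest factor on the right.
    D≈falling : ∀ m → Shifts≉0 (suc m) →
      a * D m * falling (x + fromℕ (suc m)) (suc m)
      ≈ fromℕ 2 * fromℕ (4 ^ m) * fromℕ (m !) * falling (x + fromℕ (suc m) - half) (suc m)
    D≈falling zero ≉0 = linear₂ a (fromℕ 1)
      (inverseʳ _ (≉0 1 ℕₚ.≤-refl ℕₚ.≤-refl)) half-inverse
      (solve 3 (λ x i h →
         let o = con (ℤ.+ 0)
             a = x :+ :1 :+ (x :+ :1) :- :1 in
         a :* i :* (:1 :* (x :+ :ℕ 1 :- o))
         := :ℕ 2 :* :ℕ 1 :* :ℕ 1 :* (:1 :* (x :+ :ℕ 1 :- h :- o))
            :+ a :* ((x :+ :ℕ 1) :* i :- :1) :+ :ℕ 1 :* (:ℕ 2 :* h :- :1))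
         refl x _ half)
    D≈falling (suc m) ≉0 = linear₃ (a * D (suc m)) (a * κ) (fromℕ 2 * n * w)
      (trans (trans (falling-cong (suc (suc m)) (solve 2 (λ x n → x :+ (:1 :+ n) := :1 :+ (x :+ n)) refl x n))
                    (falling-suc (x + n) (suc m)))
             (*-congʳ (solve 2 (λ x m → :1 :+ (x :+ (:1 :+ m)) := x :+ :1 :+ m :+ :1) refl x (fromℕ m))))
      (D-suc m (inverts (suc m) ≉0))
      (D≈falling m (λ j 1≤j j≤ → ≉0 j 1≤j (ℕₚ.m≤n⇒m≤1+n j≤)))
      (linear₃ (- (fromℕ 2 * g′ * ψ′)) (- (fromℕ 8 * q * ψ′)) (- (fromℕ 8 * q * n * g))
        (fromℕ-* 4 (4 ^ m)) (fromℕ-* (suc m) (m !))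
        (trans (falling-cong (suc (suc m)) (solve 3 (λ x n h → x :+ (:1 :+ n) :- h := :1 :+ (x :+ n :- h)) refl x n half))
               (falling-suc (x + n - half) (suc m)))
        (linear₁ (fromℕ 4 * n * q * g * ψ) half-inverse
          (solve 13 (λ x m h d d′ κ κ′ ψ ψ′ q q′ g g′ →
             let n = :1 :+ m
                 a = x :+ :1 :+ (x :+ :1) :- :1
                 v = x :+ :1 :+ m :+ :1
                 w = x :+ :1 :+ (x :+ :1) :+ m :+ m :+ :1 in
             a :* d′ :* κ′ := :ℕ 2 :* q′ :* g′ :* ψ′
               :+ a :* d′ :* (κ′ :- v :* κ)
               :+ a :* κ :* (v :* d′ :- :ℕ 2 :* n :* w :* d)
               :+ :ℕ 2 :* n :* w :* (a :* d :* κ :- :ℕ 2 :* q :* g :* ψ)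
               :+ :- (:ℕ 2 :* g′ :* ψ′) :* (q′ :- :ℕ 4 :* q)
               :+ :- (:ℕ 8 :* q :* ψ′) :* (g′ :- n :* g)
               :+ :- (:ℕ 8 :* q :* n :* g) :* (ψ′ :- (:1 :+ (x :+ n :- h)) :* ψ)
               :+ :ℕ 4 :* n :* q :* g :* ψ :* (:ℕ 2 :* h :- :1))
             refl x (fromℕ m) half (D m) (D (suc m)) κ κ′ ψ ψ′ q q′ g g′)))
      where
      n w κ κ′ ψ ψ′ q q′ g g′ : Carrier
      n = fromℕ (suc m)
      w = x + 1# + (x + 1#) + fromℕ m + fromℕ m + 1#
      κ = falling (x + n) (suc m)
      κ′ = falling (x + (1# + n)) (suc (suc m))
      ψ = falling (x + n - half) (suc m)
      ψ′ = falling (x + (1# + n) - half) (suc (suc m))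
      q = fromℕ (4 ^ m)
      q′ = fromℕ (4 ^ suc m)
      g = fromℕ (m !)
      g′ = fromℕ (suc m !)

    -- Clearing denominators.

    two : Carrier
    two = fromℕ 2

    summand : ℕ → ℕ → Carrier
    summand n k = pow (- 1#) k * binom (fromℕ n) k
      * (binom (two * x + fromℕ k) k ÷ binom (two * x + fromℕ n + fromℕ k) k)
      * H k x

    -- The quotient of binomials is `(a)ₖ/(a+n)ₖ`, the factorials cancelling, and
    -- `(a+n)ₙ = (a+n)ₖ (a+n+k)ₙ₋ₖ` contains its denominator.
    cleared-summand : ∀ n k → k ≤ n → ¬ (binom (two * x + fromℕ n + fromℕ k) k ≈ 0#) →
      poch (a + fromℕ n) n * summand n k ≈ Θ-term n a (a + fromℕ n) (λ k → H k x) k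
    cleared-summand n k k≤n ≉0 = linear₃ (e * (P′ * i * v) * h) (- (r * e * P′ * i * v * h)) (r * e * P′ * h)
      (trans (reflexive (≡.cong (poch (a + fromℕ n)) (≡.sym (ℕₚ.m+[n∸m]≡n k≤n))))
             (poch-split (a + fromℕ n) k (n ∸ k)))
      (trans (falling≈poch (two * x + fromℕ n) k) (poch-cong k
        (solve 2 (λ x n → :ℕ 2 :* x :+ n :+ :1 := x :+ :1 :+ (x :+ :1) :- :1 :+ n) refl x (fromℕ n))))
      (inverseʳ _ ≉0)
      (linear₁ (r * e * h)
        (trans (falling≈poch (two * x) k) (poch-cong k
          (solve 1 (λ x → :ℕ 2 :* x :+ :1 := x :+ :1 :+ (x :+ :1) :- :1) refl x)))
        (solve 10 (λ G e P P′ Q Q′ i v h r →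
           G :* (e :* (P′ :* i :* v) :* h) := e :* (P :* r) :* h
             :+ e :* (P′ :* i :* v) :* h :* (G :- Q :* r)
             :+ :- (r :* e :* P′ :* i :* v :* h) :* (Q′ :- Q)
             :+ r :* e :* P′ :* h :* (Q′ :* i :* v :- :1)
             :+ r :* e :* h :* (P′ :- P))
           refl (poch (a + fromℕ n) n) e (poch a k) P′ (poch (a + fromℕ n) k) Q′ i v h r))
      where
      e P′ Q′ i v h r : Carrier
      e = pow (- 1#) k * binom (fromℕ n) k
      P′ = falling (two * x + fromℕ k) k
      Q′ = falling (two * x + fromℕ n + fromℕ k) k
      i = fromℕ (k !) ⁻¹
      v = binom (two * x + fromℕ n + fromℕ k) k ⁻¹
      h = H k x
      r = poch (a + fromℕ n + fromℕ k) (n ∸ k)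

    harmonic-sum : ∀ m → Shifts≉0 (suc m) →
      let n = suc m in
      (∀ k → k ≤ n → ¬ (binom (two * x + fromℕ n + fromℕ k) k ≈ 0#)) →
      ¬ (binom (two * x + fromℕ (2 ℕ.* n)) n ≈ 0#) →
      ¬ (binom (x + fromℕ n) n ≈ 0#) →
      sumTo n (summand n)
      ≈ fromℕ (4 ^ m) * (binom (fromℕ n - half) n ÷ binom (two * x + fromℕ (2 ℕ.* n)) n) * S m
        - (fromℕ (4 ^ m) ÷ fromℕ n)
          * (binom (x + fromℕ n - half) n
             ÷ (binom (two * x + fromℕ (2 ℕ.* n)) n * binom (x + fromℕ n) n))
    harmonic-sum m x+j≉0 2x+n+k≉0 G≉0 κ≉0 =
      -- Multiply by `2 G`; `G` is nonzero as the numerator of `binom(2x+2n, n)`. The cleared pieces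
      -- then fit together as `2 U m = A m S m - a D m`.
      *-cancelˡ-≉0 (≉0-resp G′≈G (*-≉0ˡ G≉0)) (*-cancelˡ-≉0 (charZero 1)
        (linear₃ (fromℕ 2) 1# (- 1#) cleared-sum (W≈ m x+j≉0) main-part
          (linear₁ 1# correction
            (solve 9 (λ G l y z u d A s a →
               :ℕ 2 :* (G :* l) := :ℕ 2 :* (G :* (y :- z))
                 :+ :ℕ 2 :* (G :* l :- u)
                 :+ :1 :* (:ℕ 2 :* u :+ a :* d :- A :* s)
                 :+ :- :1 :* (:ℕ 2 :* (G :* y) :- A :* s)
                 :+ :1 :* (:ℕ 2 :* (G :* z) :- a :* d))
               refl G (sumTo n (summand n)) _ _ (U m) (D m) (A m) (S m) a))))
      where
      n = suc m

      G G′ q φ ψ κ i g ι v : Carrier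
      G = poch (a + fromℕ n) n
      G′ = falling (two * x + fromℕ (2 ℕ.* n)) n
      q = fromℕ (4 ^ m)
      φ = falling (fromℕ n - half) n
      ψ = falling (x + fromℕ n - half) n
      κ = falling (x + fromℕ n) n
      i = fromℕ (n !) ⁻¹
      g = (G′ * i) ⁻¹
      ι = fromℕ n ⁻¹
      v = (G′ * i * (κ * i)) ⁻¹

      G′≈G : G′ ≈ G
      G′≈G = begin
        falling (two * x + fromℕ (2 ℕ.* n)) n
          ≈⟨ falling-cong n (trans (+-congˡ (fromℕ-* 2 n))
               (solve 2 (λ x n → :ℕ 2 :* x :+ :ℕ 2 :* n := :ℕ 2 :* x :+ n :+ n) refl x (fromℕ n))) ⟩
        falling (two * x + fromℕ n + fromℕ n) n
          ≈⟨ falling≈poch (two * x + fromℕ n) n ⟩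
        poch (two * x + fromℕ n + 1#) n
          ≈⟨ poch-cong n (solve 2 (λ x n → :ℕ 2 :* x :+ n :+ :1
               := x :+ :1 :+ (x :+ :1) :- :1 :+ n) refl x (fromℕ n)) ⟩
        G ∎

      cleared-sum : G * sumTo n (summand n) ≈ U m
      cleared-sum = begin
        G * sumTo n (summand n)              ≈⟨ sumTo-scale n G (summand n) ⟨
        sumTo n (λ k → G * summand n k)      ≈⟨ sumTo-cong n (λ k k≤n → cleared-summand n k k≤n (2x+n+k≉0 k k≤n)) ⟩
        sumTo n (Θ-term n a (a + fromℕ n) (λ k → H k x)) ≈⟨ Θ≈sum n a (a + fromℕ n) (λ k → H k x) ⟨
        U m                                  ∎

      main-part : fromℕ 2 * (G * (q * (φ * i * g) * S m)) ≈ A m * S m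
      main-part = linear₃ (- (fromℕ 2 * q * φ * i * g * S m)) (fromℕ 2 * q * φ * S m) (- S m)
        G′≈G (inverseʳ _ G≉0) (A≈falling m)
        (solve 8 (λ G G′ q φ i g s A →
           :ℕ 2 :* (G :* (q :* (φ :* i :* g) :* s)) := A :* s
             :+ :- (:ℕ 2 :* q :* φ :* i :* g :* s) :* (G′ :- G)
             :+ :ℕ 2 :* q :* φ :* s :* (G′ :* i :* g :- :1)
             :+ :- s :* (A :- :ℕ 2 :* q :* φ))
           refl G G′ q φ i g (S m) (A m))

      ι≈ : fromℕ (m !) * i ≈ ι
      ι≈ = linear₃ (- (fromℕ (m !) * i)) ι (- (ι * i))
        (fromℕ-inverse n) (factorial-inverse n) (fromℕ-* n (m !))
        (solve 5 (λ n f N i ι → f :* i := ι :+ :- (f :* i) :* (n :* ι :- :1)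
             :+ ι :* (N :* i :- :1) :+ :- (ι :* i) :* (N :- n :* f))
           refl (fromℕ n) (fromℕ (m !)) (fromℕ (n !)) i ι)

      -- The three binomials leave one `n!` in the numerator, which the factor `1/n` turns into the
      -- `m!` of `D≈falling`.
      correction : fromℕ 2 * (G * (q * ι * (ψ * i * v))) ≈ a * D m
      correction = linear₃ (- (fromℕ 2 * q * ι * ψ * i * v)) (- (fromℕ 2 * G′ * q * ψ * i * v))
          (- (G′ * i * i * v))
        G′≈G ι≈ (D≈falling m x+j≉0)
        (linear₁ (a * D m) (inverseʳ _ (*-≉0 G≉0 κ≉0))
          (solve 11 (λ G G′ q ψ κ i ι v f a d →
             :ℕ 2 :* (G :* (q :* ι :* (ψ :* i :* v))) := a :* d
               :+ :- (:ℕ 2 :* q :* ι :* ψ :* i :* v) :* (G′ :- G)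
               :+ :- (:ℕ 2 :* G′ :* q :* ψ :* i :* v) :* (f :* i :- ι)
               :+ :- (G′ :* i :* i :* v) :* (a :* d :* κ :- :ℕ 2 :* q :* f :* ψ)
               :+ a :* d :* (G′ :* i :* (κ :* i) :* v :- :1))
             refl G G′ q ψ κ i ι v (fromℕ (m !)) a (D m)))

theorem3 : ∀ {c ℓ} (F : CharZeroField c ℓ) →
  let open CharZeroField F
      open FieldNotation F
      two = fromℕ 2
      half = (fromℕ 2) ⁻¹
  in (n : ℕ) → 1 ≤ n → (x : Carrier) →
  -- "all the expressions are defined": every denominator is nonzero
  (∀ (j : ℕ) → 1 ≤ j → j ≤ n → ¬ (x + fromℕ j ≈ 0#)) →
  (∀ (k : ℕ) → k ≤ n → ¬ (binom (two * x + fromℕ n + fromℕ k) k ≈ 0#)) →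
  ¬ (binom (two * x + fromℕ (2 Data.Nat.* n)) n ≈ 0#) →
  ¬ (binom (x + fromℕ n) n ≈ 0#) →
  sumTo n (λ k → pow (- 1#) k * binom (fromℕ n) k
                 * (binom (two * x + fromℕ k) k ÷ binom (two * x + fromℕ n + fromℕ k) k)
                 * H k x)
  ≈ fromℕ (4 ^ (n ∸ 1))
      * (binom (fromℕ n - half) n ÷ binom (two * x + fromℕ (2 Data.Nat.* n)) n)
      * (H n x + Harm n - two * Harm (2 Data.Nat.* n))
    - (fromℕ (4 ^ (n ∸ 1)) ÷ fromℕ n)
      * (binom (x + fromℕ n - half) n
         ÷ (binom (two * x + fromℕ (2 Data.Nat.* n)) n * binom (x + fromℕ n) n))
-- Matching on `1 ≤ n` makes `n ∸ 1` compute to `m`.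
theorem3 F (suc m) (s≤s z≤n) x = Field.HarmonicSum.harmonic-sum F x m
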